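{- Let $n\ge 9$ be an integer and $n_0=\min\{k\in\mathbb{N}: n\le\tfrac12(k^3-k^2)\}$. Then $$\chi_{L_2}(C_n)=\begin{cases} n_0 & n\ne \tfrac12(n_0^3-n_0^2)-1,\\ n_0+1 & n=\tfrac12(n_0^3-n_0^2)-1.\end{cases}$$
   Context: All graphs are finite and simple; $C_n$ is the cycle on $n$ vertices. A proper $k$-coloring of $G$ is a map $f$ from $V(G)$ onto $[k]=\{1,\dots,k\}$ with adjacent vertices receiving different colors; $f(S)=\{f(u):u\in S\}$ and $N_G(u)$ is the neighborhood of $u$. A proper $k$-coloring $f$ is a neighbor locating coloring if for any two distinct vertices $u,v$ with $f(u)=f(v)$ we have $f(N_G(u))\ne f(N_G(v))$; $\chi_{L_2}(G)$ is the minimum number of colors in a neighbor locating coloring of $G$. -}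

module Defs where

open import Level using (0ℓ)
open import Data.Fin.Base using (Fin; toℕ)
open import Data.Nat.Base using (ℕ; suc; _≤_; _∸_; _^_; _/_; s≤s)
open import Data.Nat.Properties using (1+n≢n)
open import Data.Product.Base using (_×_; _,_; ∃-syntax)
open import Data.Sum.Base using (_⊎_; inj₁; inj₂; swap)
open import Function.Definitions using (Surjective)
open import Relation.Binary.Core using (Rel)
open import Relation.Binary.Definitions using (Symmetric; Irreflexive)
open import Relation.Binary.PropositionalEquality.Core using (_≡_; _≢_; refl; sym; trans; cong)
open import Relation.Nullary.Negation.Core using (¬_)
open import Relation.Unary using (Pred; _∈_; _≐_)

IsMinimum : Pred ℕ 0ℓ → Pred ℕ 0ℓ
IsMinimum P m = P m × (∀ k → P k → m ≤ k)

-- Finite simple graphs; the vertex set is taken to be Fin order.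
record Graph : Set₁ where
  field
    order       : ℕ
    Adj         : Rel (Fin order) 0ℓ
    symmetric   : Symmetric Adj
    irreflexive : Irreflexive _≡_ Adj

  Vertex : Set
  Vertex = Fin order

  N : Vertex → Pred Vertex 0ℓ
  N u v = Adj u v

-- j is the cyclic successor of i on 0, 1, …, n − 1.
Next : ∀ {n} → Rel (Fin n) 0ℓ
Next {n} i j = (suc (toℕ i) ≡ toℕ j) ⊎ (suc (toℕ i) ≡ n × toℕ j ≡ 0)

cycle : (n : ℕ) → 3 ≤ n → Graph
cycle n 3≤n = record
  { order       = n
  ; Adj         = λ i j → Next i j ⊎ Next j i
  ; symmetric   = swap
  ; irreflexive = λ { refl (inj₁ p) → ¬loop 3≤n p ; refl (inj₂ p) → ¬loop 3≤n p }
  }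
  where
  3≰1 : ¬ 3 ≤ 1
  3≰1 (s≤s ())

  ¬loop : ∀ {m} → 3 ≤ m → {i : Fin m} → ¬ Next i i
  ¬loop _   (inj₁ 1+i≡i)           = 1+n≢n 1+i≡i
  ¬loop 3≤m (inj₂ (1+i≡m , i≡0)) with trans (sym 1+i≡m) (cong suc i≡0)
  ... | refl = 3≰1 3≤m

image : ∀ {A B : Set} → (A → B) → Pred A 0ℓ → Pred B 0ℓ
image f S c = ∃[ u ] (u ∈ S × f u ≡ c)

module _ (G : Graph) where
  open Graph G

  -- The colour set [k] is Fin k; colourings are required to be onto.
  record IsProperColoring {k : ℕ} (f : Vertex → Fin k) : Set where
    field
      onto   : Surjective _≡_ _≡_ f
      proper : ∀ {u v} → Adj u v → f u ≢ f v

  record IsNeighborLocating {k : ℕ} (f : Vertex → Fin k) : Set where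
    field
      isProperColoring : IsProperColoring f
      locating : ∀ {u v} → u ≢ v → f u ≡ f v → ¬ (image f (N u) ≐ image f (N v))

  HasNeighborLocatingColoring : Pred ℕ 0ℓ
  HasNeighborLocatingColoring k = ∃[ f ] IsNeighborLocating {k} f

-- χL₂ G ≔ m expresses χ_{L₂}(G) = m.
χL₂_≔_ : Graph → ℕ → Set
χL₂ G ≔ m = IsMinimum (HasNeighborLocatingColoring G) m

-- ½(k³ − k²).  For natural k we have k² ≤ k³, and k³ − k² = k · k(k − 1) is
-- even, so neither ∸ nor / loses anything.
ℓ : ℕ → ℕ
ℓ k = (k ^ 3 ∸ k ^ 2) / 2

{-# OPTIONS --safe #-}

-- Give each vertex of a coloured cycle its signature: its colour together with
-- the set of colours of its two neighbours.  A colouring is neighbour locating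
-- iff it is proper and no signature repeats, and there are ℓ k signatures on k
-- colours.
--
-- In a closed walk, the edges joining colours u and v can be counted from their
-- u-ends or from their v-ends, and both counts are determined by the signatures.
-- The closed walks a b (digons) and a b c (triangles) partition the set of all
-- signatures, so the two counts also agree on that set; removing a single
-- signature spoils the agreement, which rules out n = ℓ k − 1.
--
-- Conversely, two closed walks through a common edge can be spliced into one
-- whose signatures are those of both.  Starting from the triangles through
-- colour 0, which cover every edge, one may add any t other triangles and any d
-- digons; 3t + 2d then reaches every length except ℓ k − 1.
--
-- Ontoness is automatic: a colouring missing a colour would be a colouring with
-- one colour fewer, contradicting the bound.

module Submission where

open import Defs
open import Data.Bool.Base using (if_then_else_)
open import Data.Fin.Base as Fin using (Fin; toℕ)
import Data.Fin.Properties as Fin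
open import Data.List.Base using (List; []; _∷_; [_]; _++_; map; length; concatMap; upTo; applyUpTo; take)
open import Data.List.Membership.Propositional renaming (_∈_ to _∈ˡ_)
open import Data.List.Membership.Propositional.Properties
open import Data.List.Properties
  using (++-identityʳ; map-++; length-++; length-applyUpTo; length-map; length-take; length-upTo)
open import Data.List.Relation.Binary.Disjoint.Propositional using (Disjoint)
open import Data.List.Relation.Binary.Permutation.Propositional
  using (_↭_; ↭-refl; ↭-reflexive; ↭-sym; ↭-trans; ↭-prep; ↭-swap; ↭⇒↭ₛ; module PermutationReasoning)
import Data.List.Relation.Binary.Permutation.Propositional.Properties as Perm
open import Data.List.Relation.Binary.Permutation.Propositional.Properties
  using (shift; shifts; ↭-length; ∈-resp-↭; All-resp-↭)
import Data.List.Relation.Binary.Permutation.Setoid.Properties as PermSetoid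
open import Data.List.Relation.Unary.All as All using (All; []; _∷_)
import Data.List.Relation.Unary.All.Properties as All
open import Data.List.Relation.Unary.AllPairs using ([]; _∷_)
open import Data.List.Relation.Unary.Any using (here; there)
open import Data.List.Relation.Unary.Unique.Propositional using (Unique)
import Data.List.Relation.Unary.Unique.Propositional.Properties as Unique
open import Data.Nat.Base
open import Data.Nat.DivMod using (m*n/n≡m; _mod_; m<n⇒m%n≡m; n%n≡0)
open import Data.Nat.ListAction using (sum)
open import Data.Nat.ListAction.Properties using (sum-++; sum-↭)
open import Data.Nat.Properties
open import Data.Nat.Tactic.RingSolver using (solve-∀)
open import Data.Product.Base using (_×_; _,_; proj₁; proj₂; ∃; ∃₂)
open import Data.Sum.Base as Sum using (_⊎_; inj₁; inj₂)
open import Function.Base using (_∘_; id)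
open import Function.Definitions using (Surjective)
open import Relation.Binary.Definitions using (tri<; tri≈; tri>)
open import Relation.Binary.PropositionalEquality hiding ([_])
open import Relation.Nullary using (yes; no; does; ¬_; contradiction)
open import Relation.Nullary.Decidable using (dec-true; dec-false)
open import Relation.Unary using (_≐_)

-- Signatures

-- A colour y and the unordered pair {l , h} of neighbouring colours, stored
-- with l ≤ h.
Signature : Set
Signature = ℕ × ℕ × ℕ

sig : ℕ → ℕ → ℕ → Signature
sig x y z = y , x ⊓ z , x ⊔ z

sig-comm : ∀ x y z → sig x y z ≡ sig z y x
sig-comm x y z = cong (y ,_) (cong₂ _,_ (⊓-comm x z) (⊔-comm x z))

sig-≤ : ∀ {x z} y → x ≤ z → sig x y z ≡ (y , x , z)
sig-≤ y x≤z = cong (y ,_) (cong₂ _,_ (m≤n⇒m⊓n≡m x≤z) (m≤n⇒m⊔n≡n x≤z))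

sig-≥ : ∀ {x z} y → z ≤ x → sig x y z ≡ (y , z , x)
sig-≥ y z≤x = trans (sig-comm _ y _) (sig-≤ y z≤x)

sig-cases : ∀ x y z → sig x y z ≡ (y , x , z) ⊎ sig x y z ≡ (y , z , x)
sig-cases x y z = Sum.map (sig-≤ y) (sig-≥ y) (≤-total x z)

sig-injective : ∀ {x y z x′ y′ z′} → sig x y z ≡ sig x′ y′ z′ →
                y ≡ y′ × ((x ≡ x′ × z ≡ z′) ⊎ (x ≡ z′ × z ≡ x′))
sig-injective {x} {y} {z} {x′} {y′} {z′} eq with sig-cases x y z | sig-cases x′ y′ z′
... | inj₁ p | inj₁ q with refl ← trans (sym p) (trans eq q) = refl , inj₁ (refl , refl)
... | inj₁ p | inj₂ q with refl ← trans (sym p) (trans eq q) = refl , inj₂ (refl , refl)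
... | inj₂ p | inj₁ q with refl ← trans (sym p) (trans eq q) = refl , inj₂ (refl , refl)
... | inj₂ p | inj₂ q with refl ← trans (sym p) (trans eq q) = refl , inj₁ (refl , refl)

-- Walks

-- A walk from the arc (a , b) to the arc (c , d); it has one signature for
-- each pair of consecutive arcs.
data Walk : ℕ → ℕ → ℕ → ℕ → Set where
  []  : ∀ {a b} → Walk a b a b
  _∷_ : ∀ {y z c d} x → Walk y z c d → Walk x y c d

private variable
  a b c d x y k : ℕ

infixr 5 _⊙_
_⊙_ : ∀ {e f} → Walk x y a b → Walk a b e f → Walk x y e f
[]      ⊙ v = v
(x ∷ u) ⊙ v = x ∷ (u ⊙ v)

sigs : Walk x y c d → List Signature
sigs []                    = []
sigs {y = y} (_∷_ {z = z} x w) = sig x y z ∷ sigs w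

sigs-⊙ : ∀ {e f} (u : Walk x y a b) (v : Walk a b e f) → sigs (u ⊙ v) ≡ sigs u ++ sigs v
sigs-⊙ []      v = refl
sigs-⊙ (x ∷ u) v = cong (_ ∷_) (sigs-⊙ u v)

-- `here` also accepts the empty walk, so the final arc counts as traversed.
data Traverses (a b : ℕ) : Walk x y c d → Set where
  here  : {w : Walk a b c d} → Traverses a b w
  there : ∀ {z} {w : Walk y z c d} → Traverses a b w → Traverses a b (x ∷ w)

traverses-⊙ˡ : ∀ {p q e f} {u : Walk x y p q} {v : Walk p q e f} → Traverses a b u → Traverses a b (u ⊙ v)
traverses-⊙ˡ here      = here
traverses-⊙ˡ (there t) = there (traverses-⊙ˡ t)

traverses-⊙ʳ : ∀ {p q e f} (u : Walk x y p q) {v : Walk p q e f} → Traverses a b v → Traverses a b (u ⊙ v)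
traverses-⊙ʳ []      t = t
traverses-⊙ʳ (x ∷ u) t = there (traverses-⊙ʳ u t)

traverses-⊙⁻ : ∀ {p q e f} (u : Walk x y p q) {v : Walk p q e f} → Traverses a b (u ⊙ v) →
               Traverses a b u ⊎ Traverses a b v
traverses-⊙⁻ []      t         = inj₂ t
traverses-⊙⁻ (x ∷ u) here      = inj₁ here
traverses-⊙⁻ (x ∷ u) (there t) = Sum.map₁ there (traverses-⊙⁻ u t)

split : {w : Walk x y c d} → Traverses a b w →
        ∃₂ λ (u : Walk x y a b) (v : Walk a b c d) → w ≡ u ⊙ v
split here = [] , _ , refl
split (there t) with u , v , refl ← split t = _ ∷ u , v , refl

-- A signature depends only on two consecutive arcs. Since `l` begins and ends with the arc at which
-- `w` is cut, inserting it creates no signature beyond those of `l` and `w`.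
splice : {w : Walk x y c d} → Traverses a b w → (l : Walk a b a b) →
         ∃ λ (w′ : Walk x y c d) → sigs w′ ↭ sigs l ++ sigs w ×
         (∀ {p q} → Traverses p q l ⊎ Traverses p q w → Traverses p q w′)
splice t l with u , v , refl ← split t = u ⊙ l ⊙ v , perm , trav
  where
  open PermutationReasoning
  perm : sigs (u ⊙ l ⊙ v) ↭ sigs l ++ sigs (u ⊙ v)
  perm = begin
    sigs (u ⊙ l ⊙ v)            ≡⟨ trans (sigs-⊙ u _) (cong (sigs u ++_) (sigs-⊙ l v)) ⟩
    sigs u ++ sigs l ++ sigs v  ↭⟨ shifts (sigs u) (sigs l) ⟩
    sigs l ++ sigs u ++ sigs v  ≡⟨ cong (sigs l ++_) (sigs-⊙ u v) ⟨
    sigs l ++ sigs (u ⊙ v)      ∎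
  trav : ∀ {p q} → Traverses p q l ⊎ Traverses p q (u ⊙ v) → Traverses p q (u ⊙ l ⊙ v)
  trav (inj₁ s) = traverses-⊙ʳ u (traverses-⊙ˡ s)
  trav (inj₂ s) with traverses-⊙⁻ u s
  ... | inj₁ s′ = traverses-⊙ˡ s′
  ... | inj₂ s′ = traverses-⊙ʳ u (traverses-⊙ʳ l s′)

-- Counting edges from both ends

δ : ℕ → ℕ → ℕ
δ x y = if does (x ≟ y) then 1 else 0

δ-≡ : ∀ x → δ x x ≡ 1
δ-≡ x = cong (if_then 1 else 0) (dec-true (x ≟ x) refl)

δ-≢ : x ≢ y → δ x y ≡ 0
δ-≢ {x} {y} x≢y = cong (if_then 1 else 0) (dec-false (x ≟ y) x≢y)

-- How many v-coloured neighbours (0, 1 or 2) a vertex with the given signature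
-- has if its colour is u, and 0 otherwise.
ends : ℕ → ℕ → Signature → ℕ
ends u v (y , l , h) = δ y u * (δ l v + δ h v)

arc : ℕ → ℕ → ℕ → ℕ → ℕ
arc u v x y = δ x u * δ y v

ends-sig : ∀ u v x y z → ends u v (sig x y z) ≡ arc v u x y + arc u v y z
ends-sig u v x y z with sig-cases x y z
... | inj₁ p = trans (cong (ends u v) p) (lemma (δ y u) (δ x v) (δ z v))
  where lemma : ∀ p q r → p * (q + r) ≡ q * p + p * r
        lemma = solve-∀
... | inj₂ p = trans (cong (ends u v) p) (lemma (δ y u) (δ x v) (δ z v))
  where lemma : ∀ p q r → p * (r + q) ≡ q * p + p * r
        lemma = solve-∀

totalEnds : ℕ → ℕ → List Signature → ℕ
totalEnds u v ss = sum (map (ends u v) ss)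

-- By `ends-sig` every inner arc contributes `arc v u` on arrival and `arc u v` on departure, a sum
-- symmetric in `u` and `v`. In a nonempty walk only the first and last arcs contribute a single
-- term, and the added terms supply the missing ones.
totalEnds-telescope : ∀ u v (w : Walk x y c d) →
  totalEnds u v (sigs w) + (arc u v x y + arc v u c d) ≡
  totalEnds v u (sigs w) + (arc v u x y + arc u v c d)
totalEnds-telescope {x} {y} u v [] = +-comm (arc u v x y) (arc v u x y)
totalEnds-telescope {y = y} {c} {d} u v (_∷_ {z = z} x w) = begin
  ends u v (sig x y z) + S + (arc u v x y + arc v u c d)
    ≡⟨ cong (λ e → e + S + (arc u v x y + arc v u c d)) (ends-sig u v x y z) ⟩
  arc v u x y + arc u v y z + S + (arc u v x y + arc v u c d)
    ≡⟨ shuffle (arc v u x y) (arc u v y z) S (arc u v x y) (arc v u c d) ⟩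
  arc u v x y + arc v u x y + (S + (arc u v y z + arc v u c d))
    ≡⟨ cong (arc u v x y + arc v u x y +_) (totalEnds-telescope u v w) ⟩
  arc u v x y + arc v u x y + (S′ + (arc v u y z + arc u v c d))
    ≡⟨ cong (_+ (S′ + (arc v u y z + arc u v c d))) (+-comm (arc u v x y) (arc v u x y)) ⟩
  arc v u x y + arc u v x y + (S′ + (arc v u y z + arc u v c d))
    ≡⟨ shuffle (arc u v x y) (arc v u y z) S′ (arc v u x y) (arc u v c d) ⟨
  arc u v x y + arc v u y z + S′ + (arc v u x y + arc u v c d)
    ≡⟨ cong (λ e → e + S′ + (arc v u x y + arc u v c d)) (ends-sig v u x y z) ⟨
  ends v u (sig x y z) + S′ + (arc v u x y + arc u v c d) ∎
  where
  open ≡-Reasoning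
  S S′ : ℕ
  S  = totalEnds u v (sigs w)
  S′ = totalEnds v u (sigs w)
  shuffle : ∀ p q s r t → p + q + s + (r + t) ≡ r + p + (s + (q + t))
  shuffle = solve-∀

-- Both sides count the edges of the closed walk that join u and v.
totalEnds-comm : ∀ u v (w : Walk x y x y) → totalEnds u v (sigs w) ≡ totalEnds v u (sigs w)
totalEnds-comm {x} {y} u v w = +-cancelʳ-≡ (arc u v x y + arc v u x y) _ _
  (trans (totalEnds-telescope u v w) (cong (totalEnds v u (sigs w) +_) (+-comm (arc v u x y) (arc u v x y))))

-- Digons and triangles

data Piece : Set where
  digon    : (a b : ℕ) → Piece
  triangle : (a b c : ℕ) → Piece

base : Piece → ℕ × ℕ
base (digon a b)      = a , b
base (triangle a b c) = a , b

loop : ∀ p → let a , b = base p in Walk a b a b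
loop (digon a b)      = a ∷ b ∷ []
loop (triangle a b c) = a ∷ b ∷ c ∷ []

-- The same cycle run backwards, for walks that cross the base edge from `b` to `a`.
loopʳ : ∀ p → let a , b = base p in Walk b a b a
loopʳ (digon a b)      = b ∷ a ∷ []
loopʳ (triangle a b c) = b ∷ a ∷ c ∷ []

pieceSigs : Piece → List Signature
pieceSigs p = sigs (loop p)

-- Reversal swaps the two neighbours in each signature, which `sig` ignores, and otherwise only
-- reorders the list.
sigs-loopʳ : ∀ p → sigs (loopʳ p) ↭ pieceSigs p
sigs-loopʳ (digon a b) = ↭-swap _ _ ↭-refl
sigs-loopʳ (triangle a b c)
  rewrite sig-comm b a c | sig-comm a c b | sig-comm c b a =
  ↭-trans (↭-swap _ _ ↭-refl) (↭-trans (↭-prep _ (↭-swap _ _ ↭-refl)) (↭-swap _ _ ↭-refl))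

size : Piece → ℕ
size (digon _ _)      = 2
size (triangle _ _ _) = 3

-- In a valid piece each edge has its smaller colour first; the closing edge of a triangle is
-- therefore `(a , c)`, although `loop` crosses it from `c` to `a`.
edges : Piece → List (ℕ × ℕ)
edges (digon a b)      = (a , b) ∷ []
edges (triangle a b c) = (a , b) ∷ (b , c) ∷ (a , c) ∷ []

Valid : ℕ → Piece → Set
Valid k (digon a b)      = a < b × b < k
Valid k (triangle a b c) = a < b × b < c × c < k

-- The only valid piece to which a signature can belong; (y ⊔ l) ⊓ h is the
-- median of y, l, h because l ≤ h.
owner : Signature → Piece
owner (y , l , h) = if does (l ≟ h)
  then digon (y ⊓ l) (y ⊔ l)
  else triangle (y ⊓ l) ((y ⊔ l) ⊓ h) (y ⊔ h)

owner-digon : ∀ y l → owner (y , l , l) ≡ digon (y ⊓ l) (y ⊔ l)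
owner-digon y l rewrite dec-true (l ≟ l) refl = refl

owner-triangle : ∀ y {l h} → l < h → owner (y , l , h) ≡ triangle (y ⊓ l) ((y ⊔ l) ⊓ h) (y ⊔ h)
owner-triangle y {l} {h} l<h rewrite dec-false (l ≟ h) (<⇒≢ l<h) = refl

triangle-cong : ∀ {a b c a′ b′ c′} → a ≡ a′ → b ≡ b′ → c ≡ c′ → triangle a b c ≡ triangle a′ b′ c′
triangle-cong refl refl refl = refl

-- In a triangle the middle colour is in turn the median, the maximum and the minimum, and `owner`
-- recovers the piece each time. Hence distinct valid pieces share no signature.
∈-pieceSigs⇒owner : ∀ {s} p → Valid k p → s ∈ˡ pieceSigs p → owner s ≡ p
∈-pieceSigs⇒owner (digon a b) (a<b , _) (here refl) =
  trans (cong owner (sig-≤ b (≤-refl {a}))) (trans (owner-digon b a) (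
  cong₂ digon (m≥n⇒m⊓n≡n (<⇒≤ a<b)) (m≥n⇒m⊔n≡m (<⇒≤ a<b))))
∈-pieceSigs⇒owner (digon a b) (a<b , _) (there (here refl)) =
  trans (cong owner (sig-≤ a (≤-refl {b}))) (trans (owner-digon a b) (
  cong₂ digon (m≤n⇒m⊓n≡m (<⇒≤ a<b)) (m≤n⇒m⊔n≡n (<⇒≤ a<b))))
∈-pieceSigs⇒owner (triangle a b c) (a<b , b<c , _) (here refl) =
  trans (cong owner (sig-≤ b (<⇒≤ (<-trans a<b b<c)))) (trans (owner-triangle b (<-trans a<b b<c)) (
  triangle-cong (m≥n⇒m⊓n≡n (<⇒≤ a<b))
    (trans (cong (_⊓ c) (m≥n⇒m⊔n≡m (<⇒≤ a<b))) (m≤n⇒m⊓n≡m (<⇒≤ b<c)))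
    (m≤n⇒m⊔n≡n (<⇒≤ b<c))))
∈-pieceSigs⇒owner (triangle a b c) (a<b , b<c , _) (there (here refl)) =
  trans (cong owner (sig-≥ c (<⇒≤ a<b))) (trans (owner-triangle c a<b) (
  triangle-cong (m≥n⇒m⊓n≡n (<⇒≤ (<-trans a<b b<c)))
    (trans (cong (_⊓ b) (m≥n⇒m⊔n≡m (<⇒≤ (<-trans a<b b<c)))) (m≥n⇒m⊓n≡n (<⇒≤ b<c)))
    (m≥n⇒m⊔n≡m (<⇒≤ b<c))))
∈-pieceSigs⇒owner (triangle a b c) (a<b , b<c , _) (there (there (here refl))) =
  trans (cong owner (sig-≥ a (<⇒≤ b<c))) (trans (owner-triangle a b<c) (
  triangle-cong (m≤n⇒m⊓n≡m (<⇒≤ a<b))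
    (trans (cong (_⊓ c) (m≤n⇒m⊔n≡n (<⇒≤ a<b))) (m≤n⇒m⊓n≡m (<⇒≤ b<c)))
    (m≤n⇒m⊔n≡n (<⇒≤ (<-trans a<b b<c)))))

-- Properness and distinctness of the signatures of pieces

Proper : ℕ → Signature → Set
Proper k (y , l , h) = y < k × y ≢ l × y ≢ h

sig-proper : ∀ {k} x y z → y < k → x ≢ y → z ≢ y → Proper k (sig x y z)
sig-proper x y z y<k x≢y z≢y with sig-cases x y z
... | inj₁ p = subst (Proper _) (sym p) (y<k , ≢-sym x≢y , ≢-sym z≢y)
... | inj₂ p = subst (Proper _) (sym p) (y<k , ≢-sym z≢y , ≢-sym x≢y)

sig-proper⁻ : ∀ {k} x y z → Proper k (sig x y z) → y < k × x ≢ y × z ≢ y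
sig-proper⁻ x y z pr with sig-cases x y z
... | inj₁ p with y<k , y≢x , y≢z ← subst (Proper _) p pr = y<k , ≢-sym y≢x , ≢-sym y≢z
... | inj₂ p with y<k , y≢z , y≢x ← subst (Proper _) p pr = y<k , ≢-sym y≢x , ≢-sym y≢z

pieceSigs-proper : ∀ p → Valid k p → All (Proper k) (pieceSigs p)
pieceSigs-proper (digon a b) (a<b , b<k) =
    sig-proper a b a b<k (<⇒≢ a<b) (<⇒≢ a<b)
  ∷ sig-proper b a b (<-trans a<b b<k) (>⇒≢ a<b) (>⇒≢ a<b) ∷ []
pieceSigs-proper (triangle a b c) (a<b , b<c , c<k) =
    sig-proper a b c (<-trans b<c c<k) (<⇒≢ a<b) (>⇒≢ b<c)
  ∷ sig-proper b c a c<k (<⇒≢ b<c) (<⇒≢ a<c)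
  ∷ sig-proper c a b (<-trans a<c c<k) (>⇒≢ a<c) (>⇒≢ a<b) ∷ []
  where a<c = <-trans a<b b<c

-- The middle colours alone tell these signatures apart.
pieceSigs-unique : ∀ p → Valid k p → Unique (pieceSigs p)
pieceSigs-unique (digon a b) (a<b , _) = ((>⇒≢ a<b ∘ cong proj₁) ∷ []) ∷ [] ∷ []
pieceSigs-unique (triangle a b c) (a<b , b<c , _) =
    ((<⇒≢ b<c ∘ cong proj₁) ∷ (>⇒≢ a<b ∘ cong proj₁) ∷ [])
  ∷ ((>⇒≢ (<-trans a<b b<c) ∘ cong proj₁) ∷ []) ∷ [] ∷ []

allSigs : List Piece → List Signature
allSigs = concatMap pieceSigs

∈-allSigs⁺ : ∀ {s p ps} → p ∈ˡ ps → s ∈ˡ pieceSigs p → s ∈ˡ allSigs ps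
∈-allSigs⁺ (here refl)          s∈p = ∈-++⁺ˡ s∈p
∈-allSigs⁺ {ps = q ∷ _} (there p∈ps) s∈p = ∈-++⁺ʳ (pieceSigs q) (∈-allSigs⁺ p∈ps s∈p)

∈-allSigs⁻ : ∀ {s} ps → s ∈ˡ allSigs ps → ∃ λ p → p ∈ˡ ps × s ∈ˡ pieceSigs p
∈-allSigs⁻ (p ∷ ps) s∈ with ∈-++⁻ (pieceSigs p) s∈
... | inj₁ s∈p = p , here refl , s∈p
... | inj₂ s∈ps with q , q∈ps , s∈q ← ∈-allSigs⁻ ps s∈ps = q , there q∈ps , s∈q

allSigs-proper : ∀ {ps} → All (Valid k) ps → All (Proper k) (allSigs ps)
allSigs-proper []       = []
allSigs-proper {ps = p ∷ _} (v ∷ vs) = All.++⁺ (pieceSigs-proper p v) (allSigs-proper vs)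

allSigs-unique : ∀ {ps} → All (Valid k) ps → Unique ps → Unique (allSigs ps)
allSigs-unique []       [] = []
allSigs-unique {ps = p ∷ ps} (v ∷ vs) (p∉ps ∷ u) =
  Unique.++⁺ (pieceSigs-unique p v) (allSigs-unique vs u) disjoint
  where
  disjoint : Disjoint (pieceSigs p) (allSigs ps)
  -- A shared signature would have both pieces as its owner.
  disjoint (s∈p , s∈ps) with q , q∈ps , s∈q ← ∈-allSigs⁻ ps s∈ps =
    All.lookup p∉ps q∈ps (trans (sym (∈-pieceSigs⇒owner p v s∈p)) (∈-pieceSigs⇒owner q (All.lookup vs q∈ps) s∈q))

length-pieceSigs : ∀ p → length (pieceSigs p) ≡ size p
length-pieceSigs (digon _ _)      = refl
length-pieceSigs (triangle _ _ _) = refl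

totalSize : List Piece → ℕ
totalSize ps = sum (map size ps)

length-allSigs : ∀ ps → length (allSigs ps) ≡ totalSize ps
length-allSigs []       = refl
length-allSigs (p ∷ ps) = trans (length-++ (pieceSigs p)) (cong₂ _+_ (length-pieceSigs p) (length-allSigs ps))

-- Every piece is itself a closed walk, so the two counts agree piece by piece.
totalEnds-allSigs-comm : ∀ u v ps → totalEnds u v (allSigs ps) ≡ totalEnds v u (allSigs ps)
totalEnds-allSigs-comm u v []       = refl
totalEnds-allSigs-comm u v (p ∷ ps) = begin
  totalEnds u v (pieceSigs p ++ allSigs ps)                   ≡⟨ distrib u v ⟩
  totalEnds u v (pieceSigs p) + totalEnds u v (allSigs ps)
    ≡⟨ cong₂ _+_ (totalEnds-comm u v (loop p)) (totalEnds-allSigs-comm u v ps) ⟩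
  totalEnds v u (pieceSigs p) + totalEnds v u (allSigs ps)    ≡⟨ distrib v u ⟨
  totalEnds v u (pieceSigs p ++ allSigs ps)                   ∎
  where
  open ≡-Reasoning
  distrib : ∀ u v → totalEnds u v (pieceSigs p ++ allSigs ps) ≡ totalEnds u v (pieceSigs p) + totalEnds u v (allSigs ps)
  distrib u v = trans (cong sum (map-++ (ends u v) (pieceSigs p) (allSigs ps))) (sum-++ (map (ends u v) (pieceSigs p)) _)

-- Splicing pieces into closed walks

JoinedBy : Walk x y c d → ℕ × ℕ → Set
JoinedBy w (a , b) = Traverses a b w ⊎ Traverses b a w

-- The field `covers` is the invariant that tells where further pieces can be spliced in.
record Trail (ps : List Piece) : Set where
  field
    {start next} : ℕ
    walk   : Walk start next start next
    sigs↭  : sigs walk ↭ allSigs ps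
    covers : ∀ {p e} → p ∈ˡ ps → e ∈ˡ edges p → JoinedBy walk e

loop-covers : ∀ p {e} → e ∈ˡ edges p → JoinedBy (loop p) e
loop-covers (digon _ _)      (here refl)                 = inj₁ here
loop-covers (triangle _ _ _) (here refl)                 = inj₁ here
loop-covers (triangle _ _ _) (there (here refl))         = inj₁ (there here)
loop-covers (triangle _ _ _) (there (there (here refl))) = inj₂ (there (there here))

loopʳ-covers : ∀ p {e} → e ∈ˡ edges p → JoinedBy (loopʳ p) e
loopʳ-covers (digon _ _)      (here refl)                 = inj₂ here
loopʳ-covers (triangle _ _ _) (here refl)                 = inj₂ here
loopʳ-covers (triangle _ _ _) (there (here refl))         = inj₂ (there (there here))
loopʳ-covers (triangle _ _ _) (there (there (here refl))) = inj₁ (there here)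

Covers : List Piece → ℕ × ℕ → Set
Covers ps e = ∃ λ p → p ∈ˡ ps × e ∈ˡ edges p

single : ∀ p → Trail [ p ]
single p = record
  { walk   = loop p
  ; sigs↭  = ↭-reflexive (sym (++-identityʳ (pieceSigs p)))
  ; covers = λ { (here refl) → loop-covers p }
  }

-- The walk may meet the base edge in either direction; `loop` or `loopʳ` is spliced in to match.
attach : ∀ {ps} p → Trail ps → Covers ps (base p) → Trail (p ∷ ps)
attach {ps} p T (q , q∈ps , e∈q) = [ forward , backward ]′ (covers q∈ps e∈q)
  where
  open Trail T
  open Sum using ([_,_]′)

  attachLoop : ∀ {a b} (l : Walk a b a b) → sigs l ↭ pieceSigs p → (∀ {e} → e ∈ˡ edges p → JoinedBy l e) →
               Traverses a b walk → Trail (p ∷ ps)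
  attachLoop l l↭p l-covers t with w′ , perm , trav ← splice t l = record
    { walk   = w′
    ; sigs↭  = ↭-trans perm (Perm.++⁺ l↭p sigs↭)
    ; covers = λ { (here refl) → Sum.map (trav ∘ inj₁) (trav ∘ inj₁) ∘ l-covers
                 ; (there r∈ps) → Sum.map (trav ∘ inj₂) (trav ∘ inj₂) ∘ covers r∈ps }
    }

  forward : Traverses _ _ walk → Trail (p ∷ ps)
  forward = attachLoop (loop p) ↭-refl (loop-covers p)

  backward : Traverses _ _ walk → Trail (p ∷ ps)
  backward = attachLoop (loopʳ p) (sigs-loopʳ p) (loopʳ-covers p)

-- Attaching a piece loses no coverage, so it suffices that all bases are covered by the original
-- `ps`; the pieces of `qs` do not have to support one another.
extend : ∀ {ps qs} → All (Covers ps ∘ base) qs → Trail ps → Trail (qs ++ ps)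
extend                []       T = T
extend {qs = q ∷ qs} ((p , p∈ps , e∈p) ∷ cs) T = attach q (extend cs T) (p , ∈-++⁺ʳ qs p∈ps , e∈p)

-- Enumerating pieces

-- Grouping by the larger entry makes the step to `suc c` add one block; the counts and the fan
-- follow the same recursion.
pairs : ℕ → List (ℕ × ℕ)
pairs zero    = []
pairs (suc c) = map (_, c) (upTo c) ++ pairs c

triples : ℕ → List (ℕ × ℕ × ℕ)
triples zero    = []
triples (suc c) = map (λ (a , b) → a , b , c) (pairs c) ++ triples c

∈-pairs⁺ : a < b → b < k → (a , b) ∈ˡ pairs k
∈-pairs⁺ {k = suc c} a<b b<1+c with m<1+n⇒m<n∨m≡n b<1+c
... | inj₁ b<c  = ∈-++⁺ʳ (map (_, c) (upTo c)) (∈-pairs⁺ a<b b<c)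
... | inj₂ refl = ∈-++⁺ˡ (∈-map⁺ (_, c) (∈-upTo⁺ a<b))

∈-pairs⁻ : ∀ k {e} → e ∈ˡ pairs k → proj₁ e < proj₂ e × proj₂ e < k
∈-pairs⁻ (suc c) e∈ with ∈-++⁻ (map (_, c) (upTo c)) e∈
... | inj₁ e∈′ with _ , a∈ , refl ← ∈-map⁻ (_, c) e∈′ = ∈-upTo⁻ a∈ , n<1+n c
... | inj₂ e∈′ = let a<b , b<c = ∈-pairs⁻ c e∈′ in a<b , m<n⇒m<1+n b<c

∈-triples⁺ : a < b → b < c → c < k → (a , b , c) ∈ˡ triples k
∈-triples⁺ {k = suc m} a<b b<c c<1+m with m<1+n⇒m<n∨m≡n c<1+m
... | inj₁ c<m  = ∈-++⁺ʳ (map (λ (a , b) → a , b , m) (pairs m)) (∈-triples⁺ a<b b<c c<m)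
... | inj₂ refl = ∈-++⁺ˡ (∈-map⁺ (λ (a , b) → a , b , m) (∈-pairs⁺ a<b b<c))

∈-triples⁻ : ∀ k {a b c} → (a , b , c) ∈ˡ triples k → a < b × b < c × c < k
∈-triples⁻ (suc m) t∈ with ∈-++⁻ (map (λ (a , b) → a , b , m) (pairs m)) t∈
... | inj₁ t∈′ with _ , e∈ , refl ← ∈-map⁻ (λ (a , b) → a , b , m) t∈′ =
  let a<b , b<c = ∈-pairs⁻ m e∈ in a<b , b<c , n<1+n m
... | inj₂ t∈′ = let a<b , b<c , c<m = ∈-triples⁻ m t∈′ in a<b , b<c , m<n⇒m<1+n c<m

pairs-unique : ∀ k → Unique (pairs k)
pairs-unique zero    = []
pairs-unique (suc c) = Unique.++⁺ (Unique.map⁺ (cong proj₁) (Unique.upTo⁺ c)) (pairs-unique c) disjoint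
  where
  disjoint : Disjoint (map (_, c) (upTo c)) (pairs c)
  disjoint (e∈ , e∈′) with _ , _ , refl ← ∈-map⁻ (_, c) e∈ = <-irrefl refl (proj₂ (∈-pairs⁻ c e∈′))

triples-unique : ∀ k → Unique (triples k)
triples-unique zero    = []
triples-unique (suc c) =
  Unique.++⁺ (Unique.map⁺ (λ { refl → refl }) (pairs-unique c)) (triples-unique c) disjoint
  where
  disjoint : Disjoint (map (λ (a , b) → a , b , c) (pairs c)) (triples c)
  disjoint (t∈ , t∈′) with _ , _ , refl ← ∈-map⁻ (λ (a , b) → a , b , c) t∈ =
    <-irrefl refl (proj₂ (proj₂ (∈-triples⁻ c t∈′)))

-- Counting pieces and signatures

#pairs #triples : ℕ → ℕ
#pairs k   = length (pairs k)
#triples k = length (triples k)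

#pairs-suc : ∀ c → #pairs (suc c) ≡ c + #pairs c
#pairs-suc c = trans (length-++ (map (_, c) (upTo c)))
  (cong (_+ #pairs c) (trans (length-map (_, c) (upTo c)) (length-upTo c)))

#triples-suc : ∀ c → #triples (suc c) ≡ #pairs c + #triples c
#triples-suc c = trans (length-++ (map (λ (a , b) → a , b , c) (pairs c)))
  (cong (_+ #triples c) (length-map _ (pairs c)))

-- `#pairs k` is the binomial coefficient k(k - 1)/2; adding `k` on the left avoids truncated
-- subtraction.
#pairs*2 : ∀ k → #pairs k * 2 + k ≡ k * k
#pairs*2 zero    = refl
#pairs*2 (suc c) = begin
  #pairs (suc c) * 2 + suc c        ≡⟨ cong (λ p → p * 2 + suc c) (#pairs-suc c) ⟩
  (c + #pairs c) * 2 + suc c        ≡⟨ lemma₁ c (#pairs c) ⟩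
  (#pairs c * 2 + c) + (1 + 2 * c)  ≡⟨ cong (_+ (1 + 2 * c)) (#pairs*2 c) ⟩
  c * c + (1 + 2 * c)               ≡⟨ lemma₂ c ⟩
  suc c * suc c                     ∎
  where
  open ≡-Reasoning
  lemma₁ : ∀ c p → (c + p) * 2 + suc c ≡ (p * 2 + c) + (1 + 2 * c)
  lemma₁ = solve-∀
  lemma₂ : ∀ c → c * c + (1 + 2 * c) ≡ suc c * suc c
  lemma₂ = solve-∀

-- Both sides are the number of signatures on `k` colours: by middle colour, with k(k - 1)/2
-- multisets of two other colours for each, and by piece, three for a triangle and two for a digon.
k*#pairs : ∀ k → k * #pairs k ≡ #triples k * 3 + #pairs k * 2
k*#pairs zero    = refl
k*#pairs (suc c) = begin
  suc c * #pairs (suc c)            ≡⟨ cong (suc c *_) (#pairs-suc c) ⟩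
  suc c * (c + p)                   ≡⟨ lemma₁ c p ⟩
  c * p + c * c + (c + p)           ≡⟨ cong (λ s → c * p + s + (c + p)) (#pairs*2 c) ⟨
  c * p + (p * 2 + c) + (c + p)     ≡⟨ cong (λ s → s + (p * 2 + c) + (c + p)) (k*#pairs c) ⟩
  t * 3 + p * 2 + (p * 2 + c) + (c + p) ≡⟨ lemma₂ c p t ⟩
  (p + t) * 3 + (c + p) * 2         ≡⟨ cong₂ (λ t p → t * 3 + p * 2) (#triples-suc c) (#pairs-suc c) ⟨
  #triples (suc c) * 3 + #pairs (suc c) * 2 ∎
  where
  open ≡-Reasoning
  p t : ℕ
  p = #pairs c
  t = #triples c
  lemma₁ : ∀ c p → suc c * (c + p) ≡ c * p + c * c + (c + p)
  lemma₁ = solve-∀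
  lemma₂ : ∀ c p t → t * 3 + p * 2 + (p * 2 + c) + (c + p) ≡ (p + t) * 3 + (c + p) * 2
  lemma₂ = solve-∀

ℓ≡k*#pairs : ∀ k → ℓ k ≡ k * #pairs k
ℓ≡k*#pairs k = begin
  (k ^ 3 ∸ k ^ 2) / 2                          ≡⟨ cong (λ m → (m ∸ k ^ 2) / 2) cube ⟩
  (k * #pairs k * 2 + k ^ 2 ∸ k ^ 2) / 2       ≡⟨ cong (_/ 2) (m+n∸n≡m (k * #pairs k * 2) (k ^ 2)) ⟩
  k * #pairs k * 2 / 2                         ≡⟨ m*n/n≡m (k * #pairs k) 2 ⟩
  k * #pairs k                                 ∎
  where
  open ≡-Reasoning
  lemma₁ : ∀ k → k * (k * (k * 1)) ≡ k * (k * k)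
  lemma₁ = solve-∀
  lemma₂ : ∀ k p → k * (p * 2 + k) ≡ k * p * 2 + k * (k * 1)
  lemma₂ = solve-∀
  cube : k ^ 3 ≡ k * #pairs k * 2 + k ^ 2
  cube = trans (lemma₁ k) (trans (cong (k *_) (sym (#pairs*2 k))) (lemma₂ k (#pairs k)))

ℓ-pieces : ∀ k → ℓ k ≡ #triples k * 3 + #pairs k * 2
ℓ-pieces k = trans (ℓ≡k*#pairs k) (k*#pairs k)

-- Colour 0 is set apart: triangles through it correspond to pairs of the other `j` colours, the
-- remaining triangles to triples of them.
ℓ-fan : ∀ j → ℓ (suc j) ≡ #pairs j * 3 + (#triples j * 3 + #pairs (suc j) * 2)
ℓ-fan j = begin
  ℓ (suc j)                                          ≡⟨ ℓ-pieces (suc j) ⟩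
  #triples (suc j) * 3 + #pairs (suc j) * 2          ≡⟨ cong (λ t → t * 3 + #pairs (suc j) * 2) (#triples-suc j) ⟩
  (#pairs j + #triples j) * 3 + #pairs (suc j) * 2   ≡⟨ lemma (#pairs j) (#triples j) (#pairs (suc j)) ⟩
  #pairs j * 3 + (#triples j * 3 + #pairs (suc j) * 2) ∎
  where
  open ≡-Reasoning
  lemma : ∀ p t q → (p + t) * 3 + q * 2 ≡ p * 3 + (t * 3 + q * 2)
  lemma = solve-∀

-- Families of pieces and their sizes

totalSize-++ : ∀ ps qs → totalSize (ps ++ qs) ≡ totalSize ps + totalSize qs
totalSize-++ ps qs = trans (cong sum (map-++ size ps qs)) (sum-++ (map size ps) (map size qs))

totalSize-map : ∀ {A : Set} {m} (f : A → Piece) → (∀ x → size (f x) ≡ m) → ∀ xs → totalSize (map f xs) ≡ length xs * m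
totalSize-map f f-size []       = refl
totalSize-map f f-size (x ∷ xs) = cong₂ _+_ (f-size x) (totalSize-map f f-size xs)

toDigon : ℕ × ℕ → Piece
toDigon (a , b) = digon a b

toTriangle : ℕ × ℕ × ℕ → Piece
toTriangle (a , b , c) = triangle a b c

-- The shift by one makes room for colour 0.
fanTriangle : ℕ × ℕ → Piece
fanTriangle (a , b) = triangle 0 (suc a) (suc b)

upperTriangle : ℕ × ℕ × ℕ → Piece
upperTriangle (a , b , c) = triangle (suc a) (suc b) (suc c)

allPieces : ℕ → List Piece
allPieces k = map toTriangle (triples k) ++ map toDigon (pairs k)

totalSize-allPieces : ∀ k → totalSize (allPieces k) ≡ ℓ k
totalSize-allPieces k = trans (totalSize-++ (map toTriangle (triples k)) _)
  (trans (cong₂ _+_ (totalSize-map toTriangle (λ _ → refl) (triples k)) (totalSize-map toDigon (λ _ → refl) (pairs k)))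
         (sym (ℓ-pieces k)))

allPieces-valid : ∀ k → All (Valid k) (allPieces k)
allPieces-valid k = All.++⁺ (All.map⁺ (All.tabulate (∈-triples⁻ k))) (All.map⁺ (All.tabulate (∈-pairs⁻ k)))

-- The fan at 0

fan : ℕ → List Piece
fan j = map fanTriangle (pairs j)

-- The spoke to colour 1 lies on the triangle 0 1 2, the spoke to any later colour c on the triangle
-- 0 1 c.
fan-covers-spoke : 2 ≤ k → ∀ {x} → x < k → Covers (fan k) (0 , suc x)
fan-covers-spoke 2≤k {zero}  x<k = _ , ∈-map⁺ fanTriangle (∈-pairs⁺ z<s 2≤k) , here refl
fan-covers-spoke 2≤k {suc x} x<k = _ , ∈-map⁺ fanTriangle (∈-pairs⁺ z<s x<k) , there (there (here refl))

-- An edge avoiding 0 is opposite 0 in a fan triangle.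
fan-covers : 2 ≤ k → a < b → b < suc k → Covers (fan k) (a , b)
fan-covers {a = zero}  {suc b} 2≤k a<b b<1+k = fan-covers-spoke 2≤k (s<s⁻¹ b<1+k)
fan-covers {a = suc a} {suc b} 2≤k a<b b<1+k =
  _ , ∈-map⁺ fanTriangle (∈-pairs⁺ (s<s⁻¹ a<b) (s<s⁻¹ b<1+k)) , there (here refl)

-- By induction: the triangles through the new colour are attached along the spokes to the older
-- colours, all of which the previous fan covers.
fan-trail : ∀ j → 2 ≤ j → Trail (fan j)
fan-trail 1             (s≤s ())
fan-trail 2             _ = single _
fan-trail (suc j@(suc (suc _))) _ = subst Trail (sym (map-++ fanTriangle (map (_, j) (upTo j)) (pairs j)))
  (extend (All.map⁺ (All.map⁺ (All.tabulate λ x∈ → fan-covers-spoke 2≤j (∈-upTo⁻ x∈)))) (fan-trail j 2≤j))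
  where
  2≤j : 2 ≤ j
  2≤j = s≤s (s≤s z≤n)

-- Lengths obtained from distinct pieces

record Realizable (k n : ℕ) : Set where
  field
    {ps}   : List Piece
    trail  : Trail ps
    valid  : All (Valid k) ps
    unique : Unique ps
    total  : totalSize ps ≡ n

-- The fan covers every edge on `suc j` colours, so any digons and upper triangles can be attached;
-- `take` picks the required number of each.
family-realizable : ∀ j t d → 2 ≤ j → t ≤ #triples j → d ≤ #pairs (suc j) →
                    Realizable (suc j) (#pairs j * 3 + (t * 3 + d * 2))
family-realizable j t d 2≤j t≤ d≤ = record
  { trail = extend {qs = digons}
      (All.map⁺ (All.map (λ (a<b , b<k) → in-upper (fan-covers 2≤j a<b b<k)) digons-sorted))
      (extend {qs = uppers}
        (All.map⁺ (All.map (λ (a<b , b<c , c<j) → fan-covers 2≤j (s<s a<b) (s<s (<-trans b<c c<j))) uppers-sorted))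
        (fan-trail j 2≤j))
  ; valid = All.++⁺ (All.map⁺ digons-sorted)
      (All.++⁺ (All.map⁺ (All.map (λ (a<b , b<c , c<j) → s<s a<b , s<s b<c , s<s c<j) uppers-sorted))
               (All.map⁺ (All.map (λ (a<b , b<j) → z<s , s<s a<b , s<s b<j) (All.tabulate (∈-pairs⁻ j)))))
  ; unique = Unique.++⁺ (Unique.map⁺ (λ { refl → refl }) (Unique.take⁺ d (pairs-unique (suc j))))
      (Unique.++⁺ (Unique.map⁺ (λ { refl → refl }) (Unique.take⁺ t (triples-unique j)))
                  (Unique.map⁺ (λ { refl → refl }) (pairs-unique j)) upper#fan)
      digon#rest
  ; total = begin
      totalSize (digons ++ uppers ++ fan j)
        ≡⟨ trans (totalSize-++ digons _) (cong (totalSize digons +_) (totalSize-++ uppers (fan j))) ⟩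
      totalSize digons + (totalSize uppers + totalSize (fan j))
        ≡⟨ cong₂ _+_ (totalSize-map toDigon (λ _ → refl) (take d (pairs (suc j))))
             (cong₂ _+_ (totalSize-map upperTriangle (λ _ → refl) (take t (triples j)))
                        (totalSize-map fanTriangle (λ _ → refl) (pairs j))) ⟩
      length (take d (pairs (suc j))) * 2 + (length (take t (triples j)) * 3 + #pairs j * 3)
        ≡⟨ cong₂ (λ d t → d * 2 + (t * 3 + #pairs j * 3))
             (trans (length-take d _) (m≤n⇒m⊓n≡m d≤)) (trans (length-take t _) (m≤n⇒m⊓n≡m t≤)) ⟩
      d * 2 + (t * 3 + #pairs j * 3)
        ≡⟨ lemma d t (#pairs j) ⟩
      #pairs j * 3 + (t * 3 + d * 2) ∎
  }
  where
  open ≡-Reasoning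
  digons uppers : List Piece
  digons = map toDigon (take d (pairs (suc j)))
  uppers = map upperTriangle (take t (triples j))
  digons-sorted : All (λ (a , b) → a < b × b < suc j) (take d (pairs (suc j)))
  digons-sorted = All.take⁺ d (All.tabulate (∈-pairs⁻ (suc j)))
  uppers-sorted : All (λ (a , b , c) → a < b × b < c × c < j) (take t (triples j))
  uppers-sorted = All.take⁺ t (All.tabulate (∈-triples⁻ j))
  in-upper : ∀ {e} → Covers (fan j) e → Covers (uppers ++ fan j) e
  in-upper (p , p∈ , e∈p) = p , ∈-++⁺ʳ uppers p∈ , e∈p
  upper#fan : Disjoint uppers (fan j)
  upper#fan (p∈ , p∈′) with _ , _ , refl ← ∈-map⁻ upperTriangle p∈ with ∈-map⁻ fanTriangle p∈′
  ... | _ , _ , ()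
  digon#rest : Disjoint digons (uppers ++ fan j)
  digon#rest (p∈ , p∈′) with _ , _ , refl ← ∈-map⁻ toDigon p∈ with ∈-++⁻ uppers p∈′
  ... | inj₁ p∈″ with () ← proj₂ (proj₂ (∈-map⁻ upperTriangle p∈″))
  ... | inj₂ p∈″ with () ← proj₂ (proj₂ (∈-map⁻ fanTriangle p∈″))
  lemma : ∀ d t p → d * 2 + (t * 3 + p * 3) ≡ p * 3 + (t * 3 + d * 2)
  lemma = solve-∀

-- The fan on four colours has length 9, and the pieces have size at least 2,
-- so length 10 needs a family not containing the fan.
realizable-4-10 : Realizable 4 10
realizable-4-10 = record
  { trail  = attach (digon 0 2) (attach (digon 0 1) (attach (triangle 0 1 3) (single (triangle 0 1 2))
               (_ , here refl , here refl))
               (_ , here refl , here refl))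
               (_ , there (there (here refl)) , there (there (here refl)))
  ; valid  = (z<s , s<s (s<s z<s)) ∷ (z<s , s<s z<s) ∷ (z<s , s<s z<s , ≤-refl)
           ∷ (z<s , ≤-refl , s<s (s<s z<s)) ∷ []
  ; unique = ((λ ()) ∷ (λ ()) ∷ (λ ()) ∷ []) ∷ ((λ ()) ∷ (λ ()) ∷ []) ∷ ((λ ()) ∷ []) ∷ [] ∷ []
  ; total  = refl
  }

even-or-odd : ∀ m → ∃ λ h → m ≡ h * 2 ⊎ m ≡ suc (h * 2)
even-or-odd zero = 0 , inj₁ refl
even-or-odd (suc m) with even-or-odd m
... | h , inj₁ refl = h , inj₂ refl
... | h , inj₂ refl = suc h , inj₁ refl

-- Up to the maximum, the sums 3t + 2d miss only 1 and, by complementation, the maximum minus 1. One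
-- 3 is removed at a time until a single one is left to fix the parity.
decompose : ∀ T D m → 2 ≤ D → m ≢ 1 → m ≤ suc T * 3 + D * 2 → suc m ≢ suc T * 3 + D * 2 →
            ∃₂ λ t d → t ≤ suc T × d ≤ D × t * 3 + d * 2 ≡ m
decompose zero D m 2≤D m≢1 m≤ m≢ with even-or-odd m
... | zero  , inj₂ refl = contradiction refl m≢1
... | suc h , inj₂ refl = 1 , h , ≤-refl , *-cancelʳ-≤ h D 2 (s≤s⁻¹ (s≤s⁻¹ (s≤s⁻¹ m≤))) , refl
... | h , inj₁ refl with h ≤? D
...   | yes h≤D = 0 , h , z≤n , h≤D , refl
-- Here m is even and too large for `D` digons, which forces m = 2(D + 1), one below the maximum.
...   | no  h≰D = contradiction (cong (λ h → suc (h * 2)) (≤-antisym h≤1+D (≰⇒> h≰D))) m≢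
  where
  h≤1+D : h ≤ suc D
  h≤1+D = s≤s⁻¹ (*-cancelʳ-< 2 h (2 + D) (s≤s m≤))
decompose (suc T) D 0 2≤D m≢1 m≤ m≢ = 0 , 0 , z≤n , z≤n , refl
decompose (suc T) D 1 2≤D m≢1 m≤ m≢ = contradiction refl m≢1
decompose (suc T) D 2 2≤D m≢1 m≤ m≢ = 0 , 1 , z≤n , <⇒≤ 2≤D , refl
-- Removing a 3 would leave the excluded value 1.
decompose (suc T) D 4 2≤D m≢1 m≤ m≢ = 0 , 2 , z≤n , 2≤D , refl
decompose (suc T) D 3 2≤D m≢1 m≤ m≢ = 1 , 0 , s≤s z≤n , z≤n , refl
decompose (suc T) D (suc (suc (suc m@(suc (suc _))))) 2≤D m≢1 m≤ m≢
  with t , d , t≤ , d≤ , eq ← decompose T D m 2≤D (λ ()) (s≤s⁻¹ (s≤s⁻¹ (s≤s⁻¹ m≤))) (m≢ ∘ cong (3 +_))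
  = suc t , d , s≤s t≤ , d≤ , cong (3 +_) eq

#triples-positive : ∀ {j} → 3 ≤ j → ∃ λ t → #triples j ≡ suc t
#triples-positive {suc c} 3≤1+c = positive (∈-triples⁺ z<s (s<s z<s) 3≤1+c)
  where
  positive : ∀ {A : Set} {x : A} {xs} → x ∈ˡ xs → ∃ λ t → length xs ≡ suc t
  positive {xs = _ ∷ _} _ = _ , refl

-- Once the fan is taken out, `lower` keeps the remainder away from 1 and the last hypothesis keeps
-- it away from one below the maximum, the two gaps of `decompose`.
realizable : ∀ j n → 3 ≤ j → #pairs j * 3 + 2 ≤ n → n ≤ ℓ (suc j) → suc n ≢ ℓ (suc j) → Realizable (suc j) n
realizable j n 3≤j lower upper 1+n≢ = go (m≤n⇒∃[o]m+o≡n (m+n≤o⇒m≤o (#pairs j * 3) lower)) (#triples-positive 3≤j)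
  where
  open ≡-Reasoning
  2≤#pairs : 2 ≤ #pairs (suc j)
  2≤#pairs = subst (2 ≤_) (sym (#pairs-suc j)) (≤-trans (<⇒≤ 3≤j) (m≤m+n j _))

  go : (∃ λ m → #pairs j * 3 + m ≡ n) → (∃ λ T → #triples j ≡ suc T) → Realizable (suc j) n
  go (m , eq) (T , #triples≡) =
    let t , d , t≤ , d≤ , m≡ = decompose T (#pairs (suc j)) m 2≤#pairs m≢1 m≤ 1+m≢
    in subst (Realizable (suc j)) (trans (cong (#pairs j * 3 +_) m≡) eq)
         (family-realizable j t d (<⇒≤ 3≤j) (≤-trans t≤ (≤-reflexive (sym #triples≡))) d≤)
    where
    ℓ≡ : ℓ (suc j) ≡ #pairs j * 3 + (suc T * 3 + #pairs (suc j) * 2)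
    ℓ≡ = trans (ℓ-fan j) (cong (λ t → #pairs j * 3 + (t * 3 + #pairs (suc j) * 2)) #triples≡)
    m≢1 : m ≢ 1
    m≢1 = >⇒≢ (+-cancelˡ-≤ (#pairs j * 3) 2 m (subst (_ ≤_) (sym eq) lower))
    m≤ : m ≤ suc T * 3 + #pairs (suc j) * 2
    m≤ = +-cancelˡ-≤ (#pairs j * 3) m _ (subst₂ _≤_ (sym eq) ℓ≡ upper)
    1+m≢ : suc m ≢ suc T * 3 + #pairs (suc j) * 2
    1+m≢ 1+m≡ = 1+n≢ (begin
      suc n                  ≡⟨ cong suc eq ⟨
      suc (#pairs j * 3 + m) ≡⟨ +-suc (#pairs j * 3) m ⟨
      #pairs j * 3 + suc m   ≡⟨ cong (#pairs j * 3 +_) 1+m≡ ⟩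
      #pairs j * 3 + (suc T * 3 + #pairs (suc j) * 2) ≡⟨ ℓ≡ ⟨
      ℓ (suc j)              ∎)

-- Every proper signature belongs to a piece

digon-∈ : ∀ {s} → a < b → b < k → s ∈ˡ pieceSigs (digon a b) → s ∈ˡ allSigs (allPieces k)
digon-∈ {k = k} a<b b<k = ∈-allSigs⁺ (∈-++⁺ʳ (map toTriangle (triples k)) (∈-map⁺ toDigon (∈-pairs⁺ a<b b<k)))

triangle-∈ : ∀ {s} → a < b → b < c → c < k → s ∈ˡ pieceSigs (triangle a b c) → s ∈ˡ allSigs (allPieces k)
triangle-∈ a<b b<c c<k = ∈-allSigs⁺ (∈-++⁺ˡ (∈-map⁺ toTriangle (∈-triples⁺ a<b b<c c<k)))

-- The position of `y` below, between or above `x` and `z` selects the vertex of the triangle at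
-- which the signature sits.
sig-∈-< : ∀ {x y z} → x < z → y < k → z < k → x ≢ y → z ≢ y → sig x y z ∈ˡ allSigs (allPieces k)
sig-∈-< {x = x} {y} {z} x<z y<k z<k x≢y z≢y with <-cmp y x
... | tri< y<x _ _ = triangle-∈ y<x x<z z<k (there (there (here (sig-comm x y z))))
... | tri≈ _ y≡x _ = contradiction (sym y≡x) x≢y
... | tri> _ _ x<y with <-cmp y z
...   | tri< y<z _ _ = triangle-∈ x<y y<z z<k (here refl)
...   | tri≈ _ y≡z _ = contradiction (sym y≡z) z≢y
...   | tri> _ _ z<y = triangle-∈ x<z z<y y<k (there (here (sig-comm x y z)))

sig-∈ : ∀ {x y z} → x < k → y < k → z < k → x ≢ y → z ≢ y → sig x y z ∈ˡ allSigs (allPieces k)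
sig-∈ {k} {x} {y} {z} x<k y<k z<k x≢y z≢y with <-cmp x z
... | tri< x<z _ _ = sig-∈-< x<z y<k z<k x≢y z≢y
... | tri> _ _ z<x = subst (_∈ˡ allSigs (allPieces k)) (sig-comm z y x) (sig-∈-< z<x y<k x<k z≢y x≢y)
... | tri≈ _ refl _ with <-cmp x y
...   | tri< x<y _ _ = digon-∈ x<y y<k (here refl)
...   | tri≈ _ x≡y _ = contradiction x≡y x≢y
...   | tri> _ _ y<x = digon-∈ y<x x<k (there (here refl))

-- Colourings of a cycle as periodic sequences

sigAt : (ℕ → ℕ) → ℕ → Signature
sigAt g i = sig (g i) (g (1 + i)) (g (2 + i))

walkAlong : ∀ (g : ℕ → ℕ) n → Walk (g 0) (g 1) (g n) (g (suc n))
walkAlong g zero    = []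
walkAlong g (suc n) = g 0 ∷ walkAlong (g ∘ suc) n

sigs-walkAlong : ∀ (g : ℕ → ℕ) n → sigs (walkAlong g n) ≡ applyUpTo (sigAt g) n
sigs-walkAlong g zero    = refl
sigs-walkAlong g (suc n) = cong (sigAt g 0 ∷_) (sigs-walkAlong (g ∘ suc) n)

-- Only the first 2 + length (sigs w) values are meaningful.
at : Walk x y c d → ℕ → ℕ
at {x = x} w       zero    = x
at {y = y} []      (suc i) = y
at         (_ ∷ w) (suc i) = at w i

at-1 : (w : Walk x y c d) → at w 1 ≡ y
at-1 []      = refl
at-1 (_ ∷ w) = refl

at-end : (w : Walk x y c d) → at w (length (sigs w)) ≡ c × at w (suc (length (sigs w))) ≡ d
at-end []      = refl , refl
at-end (_ ∷ w) = at-end w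

sigs-at : (w : Walk x y c d) → sigs w ≡ applyUpTo (sigAt (at w)) (length (sigs w))
sigs-at []                          = refl
sigs-at (_∷_ {y = y} {z = z} x w) = cong₂ _∷_ (cong (sig x y) (sym (at-1 w))) (sigs-at w)

applyUpTo-injective : ∀ {A : Set} (f : ℕ → A) n → Unique (applyUpTo f n) →
                      ∀ {i j} → i < n → j < n → f i ≡ f j → i ≡ j
applyUpTo-injective f (suc n) (f0∉ ∷ u) {zero}  {zero}  _   _   _  = refl
applyUpTo-injective f (suc n) (f0∉ ∷ u) {zero}  {suc j} _   j<n eq =
  contradiction eq (All.applyUpTo⁻ (f ∘ suc) n f0∉ (s<s⁻¹ j<n))
applyUpTo-injective f (suc n) (f0∉ ∷ u) {suc i} {zero}  i<n _   eq =
  contradiction (sym eq) (All.applyUpTo⁻ (f ∘ suc) n f0∉ (s<s⁻¹ i<n))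
applyUpTo-injective f (suc n) (f0∉ ∷ u) {suc i} {suc j} i<n j<n eq =
  cong suc (applyUpTo-injective (f ∘ suc) n u (s<s⁻¹ i<n) (s<s⁻¹ j<n) eq)

-- As IsNeighborLocating, but the colouring need not be onto.
record IsLocating (G : Graph) {k : ℕ} (f : Graph.Vertex G → Fin k) : Set where
  open Graph G
  field
    proper   : ∀ {u v} → Adj u v → f u ≢ f v
    locating : ∀ {u v} → u ≢ v → f u ≡ f v → ¬ (image f (N u) ≐ image f (N v))

next : ∀ {n} (i : Fin n) → ∃ λ j → Next i j
next {suc n} i with m<1+n⇒m<n∨m≡n (Fin.toℕ<n i)
... | inj₁ i<n = Fin.fromℕ< (s<s i<n) , inj₁ (sym (Fin.toℕ-fromℕ< (s<s i<n)))
... | inj₂ i≡n = Fin.zero , inj₂ (cong suc i≡n , refl)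

prev : ∀ {n} (i : Fin n) → ∃ λ j → Next j i
prev {suc n} Fin.zero    = Fin.fromℕ n , inj₂ (cong suc (Fin.toℕ-fromℕ n) , refl)
prev {suc n} (Fin.suc i) = Fin.inject₁ i , inj₁ (cong suc (Fin.toℕ-inject₁ i))

-- g lists the colours around the cycle; g 0 is the colour of the last vertex,
-- so that sigAt g i is the signature of vertex i.
module _ {n k : ℕ} (3≤n : 3 ≤ n) (f : Fin n → Fin k) (g : ℕ → ℕ)
         (f≡g : ∀ i → toℕ (f i) ≡ g (suc (toℕ i))) (gn≡g0 : g n ≡ g 0) (g1+n≡g1 : g (suc n) ≡ g 1) where

  private
    G = cycle n 3≤n
    open Graph G

  next-colour : ∀ {i j} → Next i j → toℕ (f j) ≡ g (2 + toℕ i)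
  next-colour {i} {j} (inj₁ 1+i≡j)         = trans (f≡g j) (cong (g ∘ suc) (sym 1+i≡j))
  next-colour {i} {j} (inj₂ (1+i≡n , j≡0)) =
    trans (f≡g j) (trans (cong (g ∘ suc) j≡0) (trans (sym g1+n≡g1) (cong (g ∘ suc) (sym 1+i≡n))))

  prev-colour : ∀ {i j} → Next j i → toℕ (f j) ≡ g (toℕ i)
  prev-colour {i} {j} (inj₁ 1+j≡i)         = trans (f≡g j) (cong g 1+j≡i)
  prev-colour {i} {j} (inj₂ (1+j≡n , i≡0)) =
    trans (f≡g j) (trans (cong g 1+j≡n) (trans gn≡g0 (cong g (sym i≡0))))

  neighbour-colour : ∀ {i j} → Adj i j → toℕ (f j) ≡ g (toℕ i) ⊎ toℕ (f j) ≡ g (2 + toℕ i)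
  neighbour-colour (inj₁ p) = inj₂ (next-colour p)
  neighbour-colour (inj₂ p) = inj₁ (prev-colour p)

  image⁻ : ∀ {i c} → image f (N i) c → toℕ c ≡ g (toℕ i) ⊎ toℕ c ≡ g (2 + toℕ i)
  image⁻ (_ , adj , refl) = neighbour-colour adj

  image⁺ : ∀ {i c} → toℕ c ≡ g (toℕ i) ⊎ toℕ c ≡ g (2 + toℕ i) → image f (N i) c
  image⁺ {i} (inj₁ eq) with j , p ← prev i = j , inj₂ p , Fin.toℕ-injective (trans (prev-colour p) (sym eq))
  image⁺ {i} (inj₂ eq) with j , p ← next i = j , inj₁ p , Fin.toℕ-injective (trans (next-colour p) (sym eq))

  sigAt≡⇒ : ∀ {i j} → sigAt g (toℕ i) ≡ sigAt g (toℕ j) → f i ≡ f j × image f (N i) ≐ image f (N j)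
  sigAt≡⇒ {i} {j} eq with c≡ , nbrs ← sig-injective eq =
    Fin.toℕ-injective (trans (f≡g i) (trans c≡ (sym (f≡g j)))) , image⁺ ∘ ⊆ nbrs ∘ image⁻ , image⁺ ∘ ⊇ nbrs ∘ image⁻
    where
    ⊆ : ∀ {x z x′ z′ v : ℕ} → (x ≡ x′ × z ≡ z′) ⊎ (x ≡ z′ × z ≡ x′) → v ≡ x ⊎ v ≡ z → v ≡ x′ ⊎ v ≡ z′
    ⊆ (inj₁ (refl , refl)) = id
    ⊆ (inj₂ (refl , refl)) = Sum.swap
    ⊇ : ∀ {x z x′ z′ v : ℕ} → (x ≡ x′ × z ≡ z′) ⊎ (x ≡ z′ × z ≡ x′) → v ≡ x′ ⊎ v ≡ z′ → v ≡ x ⊎ v ≡ z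
    ⊇ (inj₁ (refl , refl)) = id
    ⊇ (inj₂ (refl , refl)) = Sum.swap

  -- A signature records a multiset and an image only a set, but multisets of size two with the same
  -- set of entries coincide. Where one inclusion is met by a repeated entry, the other decides.
  sigAt≡⇐ : ∀ {i j} → f i ≡ f j → image f (N i) ≐ image f (N j) → sigAt g (toℕ i) ≡ sigAt g (toℕ j)
  sigAt≡⇐ {i} {j} fi≡fj (⊆ , ⊇)
    with c≡ ← trans (sym (f≡g i)) (trans (cong toℕ fi≡fj) (f≡g j))
    with i₋ , p₋ ← prev i | i₊ , p₊ ← next i | j₋ , q₋ ← prev j | j₊ , q₊ ← next j = sig-≡
      (subst (λ v → v ≡ g (toℕ j) ⊎ v ≡ g (2 + toℕ j)) (prev-colour p₋) (image⁻ (⊆ (i₋ , inj₂ p₋ , refl))))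
      c≡
      (subst (λ v → v ≡ g (toℕ j) ⊎ v ≡ g (2 + toℕ j)) (next-colour p₊) (image⁻ (⊆ (i₊ , inj₁ p₊ , refl))))
      (subst (λ v → v ≡ g (toℕ i) ⊎ v ≡ g (2 + toℕ i)) (prev-colour q₋) (image⁻ (⊇ (j₋ , inj₂ q₋ , refl))))
      (subst (λ v → v ≡ g (toℕ i) ⊎ v ≡ g (2 + toℕ i)) (next-colour q₊) (image⁻ (⊇ (j₊ , inj₁ q₊ , refl))))
    where
    sig-≡ : ∀ {x y z x′ y′ z′} → x ≡ x′ ⊎ x ≡ z′ → y ≡ y′ → z ≡ x′ ⊎ z ≡ z′ → x′ ≡ x ⊎ x′ ≡ z → z′ ≡ x ⊎ z′ ≡ z →
            sig x y z ≡ sig x′ y′ z′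
    sig-≡ (inj₁ refl) refl (inj₂ refl) _ _ = refl
    sig-≡ {x} {y} (inj₂ refl) refl (inj₁ refl) _ _ = sig-comm x y _
    sig-≡ (inj₁ refl) refl (inj₁ refl) _ (inj₁ refl) = refl
    sig-≡ (inj₁ refl) refl (inj₁ refl) _ (inj₂ refl) = refl
    sig-≡ (inj₂ refl) refl (inj₂ refl) (inj₁ refl) _ = refl
    sig-≡ (inj₂ refl) refl (inj₂ refl) (inj₂ refl) _ = refl

  locating⇒injective : IsLocating G f → ∀ {i j} → sigAt g (toℕ i) ≡ sigAt g (toℕ j) → i ≡ j
  locating⇒injective loc {i} {j} eq with i Fin.≟ j
  ... | yes i≡j = i≡j
  ... | no  i≢j = let f≡ , image≐ = sigAt≡⇒ eq in contradiction image≐ (IsLocating.locating loc i≢j f≡)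

  locating⇒unique : IsLocating G f → Unique (applyUpTo (sigAt g) n)
  locating⇒unique loc = Unique.applyUpTo⁺₁ (sigAt g) n λ {i} {j} i<j j<n eq →
    let i<n = <-trans i<j j<n in
    <⇒≢ i<j (Fin.fromℕ<-injective i j i<n j<n (locating⇒injective loc
      (subst₂ (λ i j → sigAt g i ≡ sigAt g j) (sym (Fin.toℕ-fromℕ< i<n)) (sym (Fin.toℕ-fromℕ< j<n)) eq)))

  sigAt-∈ : IsLocating G f → ∀ i → sigAt g (toℕ i) ∈ˡ allSigs (allPieces k)
  sigAt-∈ loc i with i₋ , p₋ ← prev i | i₊ , p₊ ← next i =
    subst₂ (λ x z → sig x (g (suc (toℕ i))) z ∈ˡ allSigs (allPieces k)) (prev-colour p₋) (next-colour p₊)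
      (subst (λ y → sig (toℕ (f i₋)) y (toℕ (f i₊)) ∈ˡ allSigs (allPieces k)) (f≡g i)
        (sig-∈ (Fin.toℕ<n (f i₋)) (Fin.toℕ<n (f i)) (Fin.toℕ<n (f i₊))
          (proper (inj₁ p₋) ∘ Fin.toℕ-injective) (proper (inj₂ p₊) ∘ Fin.toℕ-injective)))
    where open IsLocating loc

  unique⇒locating : Unique (applyUpTo (sigAt g) n) → All (Proper k) (applyUpTo (sigAt g) n) → IsLocating G f
  unique⇒locating uniq prop = record
    { proper   = λ { (inj₁ p) → proper p ; (inj₂ p) → ≢-sym (proper p) }
    ; locating = λ i≢j f≡ image≐ → i≢j (Fin.toℕ-injective
        (applyUpTo-injective (sigAt g) n uniq (Fin.toℕ<n _) (Fin.toℕ<n _) (sigAt≡⇐ f≡ image≐)))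
    }
    where
    proper : ∀ {i j} → Next i j → f i ≢ f j
    proper {i} {j} p fi≡fj =
      let _ , _ , z≢y = sig-proper⁻ _ _ _ (All.applyUpTo⁻ (sigAt g) n prop (Fin.toℕ<n i))
      in z≢y (trans (sym (next-colour p)) (trans (cong toℕ (sym fi≡fj)) (f≡g i)))

-- The lower bound

∈-∷⁻ : ∀ {A : Set} {v x : A} {xs} → v ≢ x → v ∈ˡ x ∷ xs → v ∈ˡ xs
∈-∷⁻ v≢x (here v≡x) = contradiction v≡x v≢x
∈-∷⁻ v≢x (there v∈) = v∈

-- Each `x` is pulled out of `ys`; uniqueness keeps the later elements in what remains. The leftover
-- `zs` measures the gap.
unique-⊆⇒↭ : ∀ {A : Set} {xs ys : List A} → Unique xs → (∀ {v} → v ∈ˡ xs → v ∈ˡ ys) → ∃ λ zs → ys ↭ xs ++ zs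
unique-⊆⇒↭ {xs = []}     {ys} _          _     = ys , ↭-refl
unique-⊆⇒↭ {xs = x ∷ xs} {ys} (x∉xs ∷ u) xs⊆ys
  with as , bs , refl ← ∈-∃++ (xs⊆ys (here refl))
  with zs , perm ← unique-⊆⇒↭ u (λ v∈ → ∈-∷⁻ (≢-sym (All.lookup x∉xs v∈)) (∈-resp-↭ (shift x as bs) (xs⊆ys (there v∈))))
  = zs , ↭-trans (shift x as bs) (↭-prep x perm)

-- The counts agree on all signatures and on the closed walk, so they would agree on `s`. But for
-- the edge joining its middle colour `y` to `l`, `s` counts at least 1 from the `y`-end and 0 from
-- the `l`-end, as `y` differs from `l`. Closedness is passed as equations because the ends of
-- `walkAlong` match only propositionally.
no-single-gap : ∀ {s k} (w : Walk x y c d) → c ≡ x → d ≡ y → ¬ (allSigs (allPieces k) ↭ sigs w ++ [ s ])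
no-single-gap {s = s@(y , l , h)} {k} w refl refl perm = contradiction ends≡ ends≢
  where
  open ≡-Reasoning
  total : ∀ u v → totalEnds u v (allSigs (allPieces k)) ≡ totalEnds u v (sigs w) + ends u v s
  total u v = begin
    totalEnds u v (allSigs (allPieces k))           ≡⟨ sum-↭ (Perm.map⁺ (ends u v) perm) ⟩
    totalEnds u v (sigs w ++ [ s ])                 ≡⟨ cong sum (map-++ (ends u v) (sigs w) [ s ]) ⟩
    sum (map (ends u v) (sigs w) ++ [ ends u v s ]) ≡⟨ sum-++ (map (ends u v) (sigs w)) _ ⟩
    totalEnds u v (sigs w) + (ends u v s + 0)       ≡⟨ cong (totalEnds u v (sigs w) +_) (+-identityʳ _) ⟩
    totalEnds u v (sigs w) + ends u v s             ∎

  ends≡ : ends y l s ≡ ends l y s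
  ends≡ = +-cancelˡ-≡ (totalEnds y l (sigs w)) _ _ (begin
    totalEnds y l (sigs w) + ends y l s   ≡⟨ total y l ⟨
    totalEnds y l (allSigs (allPieces k)) ≡⟨ totalEnds-allSigs-comm y l (allPieces k) ⟩
    totalEnds l y (allSigs (allPieces k)) ≡⟨ total l y ⟩
    totalEnds l y (sigs w) + ends l y s   ≡⟨ cong (_+ ends l y s) (totalEnds-comm l y w) ⟩
    totalEnds y l (sigs w) + ends l y s   ∎)

  s-proper : Proper k s
  s-proper = All.lookup (allSigs-proper (allPieces-valid k)) (∈-resp-↭ (↭-sym perm) (∈-++⁺ʳ (sigs w) (here refl)))

  ends≢ : ends y l s ≢ ends l y s
  ends≢ eq with () ← trans (sym (cong₂ (λ p q → p * (q + δ h l)) (δ-≡ y) (δ-≡ l)))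
                       (trans eq (cong (_* (δ l y + δ h y)) (δ-≢ (proj₁ (proj₂ s-proper)))))

-- The signatures of the colouring are distinct members of the list of all `ℓ k` signatures; the
-- number left over is ℓ k - n, and it cannot be 1.
locating⇒bound : ∀ {n k} (3≤n : 3 ≤ n) {f : Fin n → Fin k} → IsLocating (cycle n 3≤n) f → n ≤ ℓ k × suc n ≢ ℓ k
locating⇒bound {n@(suc m)} {k} 3≤n {f} loc =
  let zs , perm = unique-⊆⇒↭ (locating⇒unique 3≤n f g f≡g gn≡g0 g1+n≡g1 loc) ⊆all
  in subst (n ≤_) (sym (ℓ≡ zs perm)) (m≤m+n n _) ,
     λ 1+n≡ℓ → gap≢1 zs perm (+-cancelˡ-≡ n _ 1 (trans (sym (ℓ≡ zs perm)) (trans (sym 1+n≡ℓ) (+-comm 1 n))))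
  where
  g : ℕ → ℕ
  g zero    = toℕ (f (Fin.fromℕ m))
  -- Reduction modulo `n` lets the sequence run past the last vertex: `g (suc n)` must be the colour
  -- of vertex 0.
  g (suc i) = toℕ (f (i mod n))

  toℕ-mod : ∀ i → toℕ (i mod n) ≡ i % n
  toℕ-mod i = Fin.toℕ-fromℕ< _

  f≡g : ∀ i → toℕ (f i) ≡ g (suc (toℕ i))
  f≡g i = cong (toℕ ∘ f) (Fin.toℕ-injective (sym (trans (toℕ-mod (toℕ i)) (m<n⇒m%n≡m (Fin.toℕ<n i)))))

  gn≡g0 : g n ≡ g 0
  gn≡g0 = cong (toℕ ∘ f) (Fin.toℕ-injective
    (trans (toℕ-mod m) (trans (m<n⇒m%n≡m (n<1+n m)) (sym (Fin.toℕ-fromℕ m)))))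

  g1+n≡g1 : g (suc n) ≡ g 1
  g1+n≡g1 = cong (toℕ ∘ f) (Fin.toℕ-injective
    (trans (toℕ-mod n) (trans (n%n≡0 n) (sym (toℕ-mod 0)))))

  ss = applyUpTo (sigAt g) n

  ⊆all : ∀ {s} → s ∈ˡ ss → s ∈ˡ allSigs (allPieces k)
  ⊆all s∈ with i , i<n , refl ← ∈-applyUpTo⁻ (sigAt g) s∈ =
    subst (λ i → sigAt g i ∈ˡ allSigs (allPieces k)) (Fin.toℕ-fromℕ< i<n)
      (sigAt-∈ 3≤n f g f≡g gn≡g0 g1+n≡g1 loc (Fin.fromℕ< i<n))

  ℓ≡ : ∀ zs → allSigs (allPieces k) ↭ ss ++ zs → ℓ k ≡ n + length zs
  ℓ≡ zs perm = begin
    ℓ k                             ≡⟨ totalSize-allPieces k ⟨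
    totalSize (allPieces k)         ≡⟨ length-allSigs (allPieces k) ⟨
    length (allSigs (allPieces k))  ≡⟨ ↭-length perm ⟩
    length (ss ++ zs)               ≡⟨ length-++ ss ⟩
    length ss + length zs           ≡⟨ cong (_+ length zs) (length-applyUpTo (sigAt g) n) ⟩
    n + length zs                   ∎
    where open ≡-Reasoning

  gap≢1 : ∀ zs → allSigs (allPieces k) ↭ ss ++ zs → length zs ≢ 1
  gap≢1 (z ∷ []) perm _ = no-single-gap {k = k} (walkAlong g n) gn≡g0 g1+n≡g1
    (subst (λ ss → allSigs (allPieces k) ↭ ss ++ [ z ]) (sym (sigs-walkAlong g n)) perm)

-- Existence

-- The colouring is read off along the walk; distinct valid pieces make its signatures distinct and
-- proper.
realizable⇒locating : ∀ {n k} (3≤n : 3 ≤ n) → Realizable k n → ∃ λ (f : Fin n → Fin k) → IsLocating (cycle n 3≤n) f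
realizable⇒locating {n} {k} 3≤n r = f , unique⇒locating 3≤n f g (λ i → Fin.toℕ-fromℕ< (bound i)) gn≡g0 g1+n≡g1
  (subst Unique sigs≡ (PermSetoid.Unique-resp-↭ (setoid Signature) (↭⇒↭ₛ (↭-sym sigs↭)) (allSigs-unique valid unique)))
  sigs-proper
  where
  open Realizable r
  open Trail trail

  g : ℕ → ℕ
  g = at walk

  length≡ : length (sigs walk) ≡ n
  length≡ = trans (↭-length sigs↭) (trans (length-allSigs ps) total)

  sigs≡ : sigs walk ≡ applyUpTo (sigAt g) n
  sigs≡ = trans (sigs-at walk) (cong (applyUpTo (sigAt g)) length≡)

  sigs-proper : All (Proper k) (applyUpTo (sigAt g) n)
  sigs-proper = subst (All (Proper k)) sigs≡ (All-resp-↭ (↭-sym sigs↭) (allSigs-proper valid))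

  bound : ∀ (i : Fin n) → g (suc (toℕ i)) < k
  -- `sigAt g i` has middle colour `g (suc i)`, which properness places below `k`.
  bound i = proj₁ (All.applyUpTo⁻ (sigAt g) n sigs-proper (Fin.toℕ<n i))

  f : Fin n → Fin k
  f i = Fin.fromℕ< (bound i)

  gn≡g0 : g n ≡ g 0
  gn≡g0 = trans (cong g (sym length≡)) (proj₁ (at-end walk))

  g1+n≡g1 : g (suc n) ≡ g 1
  g1+n≡g1 = trans (cong (g ∘ suc) (sym length≡)) (trans (proj₂ (at-end walk)) (sym (at-1 walk)))

-- Deleting a missed colour with `punchOut` relabels the others injectively, so the result would
-- still be locating.
locating⇒onto : ∀ {G k} {f : Graph.Vertex G → Fin (suc k)} → IsLocating G f →
                (∀ (f′ : Graph.Vertex G → Fin k) → ¬ IsLocating G f′) → IsNeighborLocating G f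
locating⇒onto {G} {k} {f} loc none = record
  { isProperColoring = record { onto = onto ; proper = proper }
  ; locating         = locating
  }
  where
  open IsLocating loc
  open Graph G

  onto : Surjective _≡_ _≡_ f
  onto c with Fin.any? (λ u → f u Fin.≟ c)
  ... | yes (u , fu≡c) = u , λ { refl → fu≡c }
  ... | no  missed     = contradiction loc′ (none f′)
    where
    c≢f : ∀ u → c ≢ f u
    c≢f u c≡fu = missed (u , sym c≡fu)

    f′ : Vertex → Fin k
    f′ u = Fin.punchOut (c≢f u)

    f′-injective : ∀ {u v} → f′ u ≡ f′ v → f u ≡ f v
    f′-injective = Fin.punchOut-injective (c≢f _) (c≢f _)

    image-⊆ : ∀ {u v} → (∀ {x} → image f′ (N u) x → image f′ (N v) x) → ∀ {x} → image f (N u) x → image f (N v) x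
    image-⊆ sub (w , w∈ , refl) with w′ , w′∈ , eq ← sub (w , w∈ , refl) = w′ , w′∈ , f′-injective eq

    loc′ : IsLocating G f′
    loc′ = record
      { proper   = λ adj → proper adj ∘ f′-injective
      ; locating = λ u≢v f′≡ (⊆ , ⊇) → locating u≢v (f′-injective f′≡) (image-⊆ ⊆ , image-⊆ ⊇)
      }

neighborLocating⇒locating : ∀ {G k} {f : Graph.Vertex G → Fin k} → IsNeighborLocating G f → IsLocating G f
neighborLocating⇒locating nl = record
  { proper   = IsProperColoring.proper (IsNeighborLocating.isProperColoring nl)
  ; locating = IsNeighborLocating.locating nl
  }

-- Numerical range of the construction

ℓ-< : ∀ j → 1 ≤ j → ℓ j < ℓ (suc j)
ℓ-< j@(suc _) _ = begin-strict
  ℓ j                            ≡⟨ ℓ≡k*#pairs j ⟩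
  j * #pairs j                   <⟨ m<m+n (j * #pairs j) z<s ⟩
  j * #pairs j + (j + #pairs j + j * j) ≡⟨ lemma j (#pairs j) ⟩
  suc j * (j + #pairs j)         ≡⟨ cong (suc j *_) (#pairs-suc j) ⟨
  suc j * #pairs (suc j)         ≡⟨ ℓ≡k*#pairs (suc j) ⟨
  ℓ (suc j)                      ∎
  where
  open ≤-Reasoning
  lemma : ∀ j p → j * p + (j + p + j * j) ≡ suc j * (j + p)
  lemma = solve-∀

-- The fan on `suc j` colours has length 3 · `#pairs j`, so the fan-based lengths start below `ℓ j`.
-- The margin is 3 and not 2 because the exceptional length is ℓ j - 1.
#pairs*3+3≤ℓ : ∀ j → 4 ≤ j → #pairs j * 3 + 3 ≤ ℓ j
#pairs*3+3≤ℓ j@(suc i) 4≤j = begin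
  #pairs j * 3 + 3          ≤⟨ +-monoʳ-≤ (#pairs j * 3) 3≤#pairs ⟩
  #pairs j * 3 + #pairs j   ≡⟨ lemma (#pairs j) ⟩
  4 * #pairs j              ≤⟨ *-monoˡ-≤ (#pairs j) 4≤j ⟩
  j * #pairs j              ≡⟨ ℓ≡k*#pairs j ⟨
  ℓ j                       ∎
  where
  open ≤-Reasoning
  lemma : ∀ p → p * 3 + p ≡ 4 * p
  lemma = solve-∀
  3≤#pairs : 3 ≤ #pairs j
  3≤#pairs = subst (3 ≤_) (sym (#pairs-suc i)) (≤-trans (s≤s⁻¹ 4≤j) (m≤m+n i _))

realizable-above : ∀ j {n} → 9 ≤ n → ℓ j < n → n ≤ ℓ (suc j) → suc n ≢ ℓ (suc j) → Realizable (suc j) n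
-- `ℓ 1` = 0 and `ℓ 2` = 2 are too small for n ≥ 9.
realizable-above 0 9≤n _ n≤ _ = contradiction (≤-trans 9≤n n≤) λ ()
realizable-above 1 9≤n _ n≤ _ = contradiction (≤-trans 9≤n n≤) λ { (s≤s (s≤s ())) }
-- `ℓ 3` = 9 forces n = 9, which uses every piece on three colours: one triangle and three digons.
realizable-above 2 {n} 9≤n _ n≤ _ =
  subst (Realizable 3) (≤-antisym 9≤n n≤) (family-realizable 2 0 3 ≤-refl z≤n ≤-refl)
-- As `ℓ 3` = 9, only 10 falls below 11, where `realizable` starts for four colours.
realizable-above 3 {n} 9≤n 9<n n≤ 1+n≢ with n ≟ 10
... | yes refl = realizable-4-10
... | no  n≢10 = realizable 3 n ≤-refl (≤∧≢⇒< 9<n (≢-sym n≢10)) n≤ 1+n≢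
realizable-above j@(suc (suc (suc (suc _)))) {n} 9≤n ℓ<n n≤ 1+n≢ =
  realizable j n (s≤s (s≤s (s≤s z≤n)))
    (≤-trans (+-monoʳ-≤ (#pairs j * 3) (n≤1+n 2)) (≤-trans (#pairs*3+3≤ℓ j (s≤s (s≤s (s≤s (s≤s z≤n))))) (<⇒≤ ℓ<n)))
    n≤ 1+n≢

realizable-below : ∀ j {n} → 9 ≤ n → suc n ≡ ℓ j → Realizable (suc j) n
realizable-below 0 9≤n ()
realizable-below 1 9≤n ()
-- `ℓ 2` = 2 and `ℓ 3` = 9 would give n = 1 and n = 8.
realizable-below 2 (s≤s ()) refl
realizable-below 3 9≤n refl = contradiction 9≤n (<⇒≱ ≤-refl)
realizable-below j@(suc (suc (suc (suc _)))) {n} 9≤n 1+n≡ℓ =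
  realizable j n (s≤s (s≤s (s≤s z≤n)))
    (s≤s⁻¹ (subst₂ _≤_ (+-suc (#pairs j * 3) 2) (sym 1+n≡ℓ) (#pairs*3+3≤ℓ j (s≤s (s≤s (s≤s (s≤s z≤n)))))))
    (<⇒≤ (<-trans (n<1+n n) 1+n<ℓ)) (<⇒≢ 1+n<ℓ)
  where
  1+n<ℓ : suc n < ℓ (suc j)
  1+n<ℓ = subst (_< ℓ (suc j)) (sym 1+n≡ℓ) (ℓ-< j (s≤s z≤n))

-- Comparing the two bounds at `n₀`

theorem3 : (n : ℕ) (9≤n : 9 ≤ n) (n₀ : ℕ) → IsMinimum (λ k → n ≤ ℓ k) n₀ →
    let Cₙ = cycle n (≤-trans (m≤m+n 3 6) 9≤n) in
    (n ≢ ℓ n₀ ∸ 1 → χL₂ Cₙ ≔ n₀) ×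
    (n ≡ ℓ n₀ ∸ 1 → χL₂ Cₙ ≔ suc n₀)
theorem3 n 9≤n zero (n≤ℓ , _) = contradiction (≤-trans 9≤n n≤ℓ) λ ()
theorem3 n 9≤n n₀@(suc j) (n≤ℓ , minimal) = generic , exceptional
  where
  3≤n : 3 ≤ n
  3≤n = ≤-trans (m≤m+n 3 6) 9≤n
  Cₙ = cycle n 3≤n

  -- The truncated subtraction is exact because `ℓ n₀` is at least n ≥ 9.
  1+n≡ℓ : n ≡ ℓ n₀ ∸ 1 → suc n ≡ ℓ n₀
  1+n≡ℓ n≡ = trans (cong suc n≡) (m+[n∸m]≡n (≤-trans (≤-trans (s≤s z≤n) 9≤n) n≤ℓ))

  n₀-lower : ∀ k → HasNeighborLocatingColoring Cₙ k → n₀ ≤ k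
  n₀-lower k (_ , nl) = minimal k (proj₁ (locating⇒bound 3≤n (neighborLocating⇒locating nl)))

  generic : n ≢ ℓ n₀ ∸ 1 → χL₂ Cₙ ≔ n₀
  -- Ontoness: a locating map into `j` colours would give n ≤ ℓ j, against the minimality of `n₀`.
  generic n≢ = (f , locating⇒onto loc λ _ loc′ → 1+n≰n (minimal j (proj₁ (locating⇒bound 3≤n loc′)))) , n₀-lower
    where
    ℓj<n : ℓ j < n
    ℓj<n = ≰⇒> (1+n≰n ∘ minimal j)
    coloring = realizable⇒locating 3≤n (realizable-above j 9≤n ℓj<n n≤ℓ (n≢ ∘ cong (_∸ 1)))
    f = proj₁ coloring
    loc = proj₂ coloring

  exceptional : n ≡ ℓ n₀ ∸ 1 → χL₂ Cₙ ≔ suc n₀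
  -- Here one colour fewer means `n₀` colours, which the gap of exactly one signature excludes.
  exceptional n≡ = (f , locating⇒onto loc λ _ loc′ → proj₂ (locating⇒bound 3≤n loc′) (1+n≡ℓ n≡)) , lower
    where
    coloring = realizable⇒locating 3≤n (realizable-below n₀ 9≤n (1+n≡ℓ n≡))
    f = proj₁ coloring
    loc = proj₂ coloring
    lower : ∀ k → HasNeighborLocatingColoring Cₙ k → suc n₀ ≤ k
    lower k has@(_ , nl) = ≤∧≢⇒< (n₀-lower k has)
      λ { refl → proj₂ (locating⇒bound 3≤n (neighborLocating⇒locating nl)) (1+n≡ℓ n≡) }
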